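{- Let $\mathcal{F}$ be a class of simple graphs and consider the assertions: (1) $\mathcal{F}$ is closed under taking induced subgraphs; (2) $\equiv_{\mathcal{F}}$ is preserved under left lexicographic products, i.e.\ for all simple graphs $G,H,H'$, if $H\equiv_{\mathcal{F}}H'$ then $G\cdot H\equiv_{\mathcal{F}}G\cdot H'$; (3) $\mathrm{cl}(\mathcal{F})$ is closed under taking induced subgraphs. Then (1) implies (2), and (2) and (3) are equivalent.
   Context: All graphs are finite, undirected, without multiple edges; simple means without loops. $\hom(F,G)$ counts homomorphisms $F\to G$; $G\equiv_{\mathcal{F}}H$ means $\hom(F,G)=\hom(F,H)$ for all $F\in\mathcal{F}$; $\mathrm{cl}(\mathcal{F})$ is the class of all simple graphs $K$ such that for all simple $G,H$, $G\equiv_{\mathcal{F}}H$ implies $\hom(K,G)=\hom(K,H)$. The lexicographic product $G\cdot H$ has vertex set $V(G)\times V(H)$, with $(g,h)$ adjacent to $(g',h')$ iff either $g=g'$ and $hh'\in E(H)$, or $gg'\in E(G)$. -}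

module Defs where

open import Data.Empty using (⊥)
open import Data.Fin.Base using (Fin; finToFun; remQuot)
open import Data.Fin.Properties using (_≟_; all?)
open import Data.List.Base using (length; filter; allFin)
open import Data.Nat.Base using (ℕ; _*_; _^_)
open import Data.Product.Base using (_×_; _,_; Σ-syntax)
open import Data.Sum.Base using (_⊎_; inj₁; inj₂)
open import Function.Base using (_on_)
open import Function.Bundles using (_⇔_)
open import Function.Definitions using (Injective)
open import Level using (Level; 0ℓ; _⊔_) renaming (suc to lsuc)
open import Relation.Binary.Core using (Rel)
open import Relation.Binary.Definitions using (Decidable; Symmetric; Irreflexive)
open import Relation.Binary.PropositionalEquality using (_≡_; refl; sym)
open import Relation.Nullary.Decidable using (Dec; _×-dec_; _⊎-dec_; _→-dec_)
open import Relation.Unary using (Pred; _∈_)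

private
  variable
    ℓ : Level

-- The order may be 0: the graph without vertices is a simple graph.
record SimpleGraph : Set₁ where
  field
    order    : ℕ
    Adj      : Rel (Fin order) 0ℓ
    adj?     : Decidable Adj
    adj-sym  : Symmetric Adj
    loopless : Irreflexive _≡_ Adj

open SimpleGraph public

V : SimpleGraph → Set
V G = Fin (order G)

IsHom : (F G : SimpleGraph) → (V F → V G) → Set
IsHom F G f = ∀ u v → Adj F u v → Adj G (f u) (f v)

isHom? : ∀ F G (f : V F → V G) → Dec (IsHom F G f)
isHom? F G f = all? λ u → all? λ v → adj? F u v →-dec adj? G (f u) (f v)

-- finToFun enumerates the maps V F → V G, each exactly once up to
-- pointwise equality.
hom : SimpleGraph → SimpleGraph → ℕ
hom F G =
  length (filter (λ i → isHom? F G (finToFun i)) (allFin (order G ^ order F)))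

HomIndist : Pred SimpleGraph ℓ → Rel SimpleGraph (lsuc 0ℓ ⊔ ℓ)
HomIndist 𝓕 G H = ∀ F → F ∈ 𝓕 → hom F G ≡ hom F H

syntax HomIndist 𝓕 G H = G ≡[ 𝓕 ] H

cl : Pred SimpleGraph ℓ → Pred SimpleGraph (lsuc 0ℓ ⊔ ℓ)
cl 𝓕 K = ∀ G H → G ≡[ 𝓕 ] H → hom K G ≡ hom K H

LexAdj : (G H : SimpleGraph) → Rel (V G × V H) 0ℓ
LexAdj G H (g , h) (g′ , h′) = (g ≡ g′ × Adj H h h′) ⊎ Adj G g g′

infixl 7 _·_

-- V (G · H) is identified with V G × V H along the bijection remQuot.
_·_ : SimpleGraph → SimpleGraph → SimpleGraph
G · H = record
  { order    = order G * order H
  ; Adj      = LexAdj G H on remQuot (order H)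
  ; adj?     = λ x y → lex? (remQuot (order H) x) (remQuot (order H) y)
  ; adj-sym  = λ {x} {y} → lex-sym (remQuot (order H) x) (remQuot (order H) y)
  ; loopless = λ { {x} refl → lex-irrefl (remQuot (order H) x) }
  }
  where
  lex? : Decidable (LexAdj G H)
  lex? (g , h) (g′ , h′) = (g ≟ g′ ×-dec adj? H h h′) ⊎-dec adj? G g g′

  lex-sym : ∀ p q → LexAdj G H p q → LexAdj G H q p
  lex-sym _ _ (inj₁ (eq , a)) = inj₁ (sym eq , adj-sym H a)
  lex-sym _ _ (inj₂ a)        = inj₂ (adj-sym G a)

  lex-irrefl : ∀ p → LexAdj G H p p → ⊥
  lex-irrefl _ (inj₁ (_ , a)) = loopless H refl a
  lex-irrefl _ (inj₂ a)       = loopless G refl a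

-- K′ is isomorphic to the subgraph of K induced by the range of the map;
-- every set of vertices of K, including ∅, arises as such a range.
IsInducedSubgraph : SimpleGraph → SimpleGraph → Set
IsInducedSubgraph K′ K =
  Σ[ f ∈ (V K′ → V K) ]
    Injective _≡_ _≡_ f × (∀ u v → Adj K′ u v ⇔ Adj K (f u) (f v))

ClosedUnderInducedSubgraphs : Pred SimpleGraph ℓ → Set (lsuc 0ℓ ⊔ ℓ)
ClosedUnderInducedSubgraphs 𝓕 =
  ∀ K K′ → K ∈ 𝓕 → IsInducedSubgraph K′ K → K′ ∈ 𝓕

PreservedUnderLeftLex : Pred SimpleGraph ℓ → Set (lsuc 0ℓ ⊔ ℓ)
PreservedUnderLeftLex 𝓕 =
  ∀ G H H′ → H ≡[ 𝓕 ] H′ → (G · H) ≡[ 𝓕 ] (G · H′)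

{-# OPTIONS --safe #-}

-- For g : V F → V G let F ∣ g be F without the edges between different fibres of g. Then
-- hom(F, G · H) is the sum of hom(F ∣ g, H) over the maps g that send each edge of F to an
-- edge or to a point. As F ∣ g is the disjoint union of induced subgraphs of F, (1) implies
-- (2); the same for cl(𝓕) in place of 𝓕 shows that (3) implies (2).
--
-- Conversely let K ∈ cl(𝓕) and H ≡ H′. Apply (2) to a complete graph G and the tensor
-- products T ⊗ H ≡ T ⊗ H′: for every T the sum over all g of hom(K ∣ g, T) hom(K ∣ g, H) is
-- unchanged when H becomes H′. All graphs K ∣ g have the same number of vertices, so after
-- inclusion–exclusion over the vertices of T only bijective homomorphisms count, and induction
-- on the number of edges isolates hom(K ∣ g, H) = hom(K ∣ g, H′) for each g. If g collapses
-- the vertices of an induced subgraph K′ and is injective elsewhere, then K ∣ g is K′ plus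
-- isolated vertices; for injective g the graph is edgeless, so |H| = |H′| (unless K is empty)
-- and the isolated vertices cancel.
module Submission where

open import Defs
import Algebra.Properties.Semiring.Sum
open import Data.Bool.Base using (true; false; if_then_else_)
open import Data.Empty using (⊥-elim)
open import Data.Fin.Base using (Fin; zero; suc; combine; remQuot; finToFun; funToFin; punchOut)
open import Data.Fin.Permutation using (permutation)
open import Data.Fin.Properties using
  ( _≟_; all?; any?; suc-injective; combine-injective; combine-remQuot; remQuot-combine
  ; funToFin-finToFin; finToFun-funToFin; punchOut-injective; punchOut-cong; injective⇒≤; 0≢1+n)
open import Data.List.Base using (List; []; _∷_; length; filter; tabulate; allFin)
open import Data.List.Membership.Propositional.Properties using (∈-allFin)
open import Data.List.Relation.Unary.All as All using (All; []; _∷_)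
open import Data.Nat.Base using
  ( ℕ; zero; suc; _+_; _*_; _^_; _≤_; _<_; z≤n; s≤s
  ; NonZero; >-nonZero; ≢-nonZero)
import Data.Nat.Properties as ℕ
open import Data.Product.Base using (_×_; _,_; ∃; ∃₂; proj₁; proj₂; swap)
open import Data.Sum.Base as Sum using (_⊎_; inj₁; inj₂; [_,_]′)
open import Data.Unit.Base using (tt)
open import Function.Base using (_∘_; id; const)
open import Function.Bundles using (_⇔_; mk⇔; Equivalence)
open import Function.Definitions using (Injective)
open import Level using (Level; 0ℓ)
open import Relation.Binary.Definitions using (tri<; tri≈; tri>)
open import Relation.Binary.PropositionalEquality
  using (_≡_; _≢_; _≗_; refl; sym; trans; cong; cong₂; subst; subst₂; module ≡-Reasoning)
open import Relation.Nullary using (Dec; yes; no; does; ¬_; contradiction)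
open import Relation.Nullary.Decidable using (_×-dec_; _→-dec_; _⊎-dec_; ¬?; decidable-stable)
open import Relation.Unary using (Pred; Decidable)
open import Relation.Unary.Properties using (U?)

open Algebra.Properties.Semiring.Sum ℕ.+-*-semiring
  using (sum; sum-syntax; sum-cong-≗; ∑-comm; ∑-distrib-+; *-distribˡ-sum; *-distribʳ-sum; sum-permute)

private
  variable
    p q : Level
    P Q R : Set p
    k l m n : ℕ

-- Indicators of decidable propositions and finite sums.

⟦_⟧ : Dec P → ℕ
⟦ d ⟧ = if does d then 1 else 0

⟦⟧-yes : (d : Dec P) → P → ⟦ d ⟧ ≡ 1
⟦⟧-yes (yes _) _ = refl
⟦⟧-yes (no ¬p) p = contradiction p ¬p

⟦⟧-no : (d : Dec P) → ¬ P → ⟦ d ⟧ ≡ 0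
⟦⟧-no (yes p) ¬p = contradiction p ¬p
⟦⟧-no (no _)  _  = refl

⟦⟧≢0 : (d : Dec P) → ⟦ d ⟧ ≢ 0 → P
⟦⟧≢0 (yes p) _ = p
⟦⟧≢0 (no _)  h = contradiction refl h

⟦⟧-cong : (d : Dec P) (e : Dec Q) → (P → Q) → (Q → P) → ⟦ d ⟧ ≡ ⟦ e ⟧
⟦⟧-cong (yes p) e f _ = sym (⟦⟧-yes e (f p))
⟦⟧-cong (no ¬p) e _ g = sym (⟦⟧-no e (¬p ∘ g))

⟦⟧-× : (d : Dec P) (e : Dec Q) → ⟦ d ×-dec e ⟧ ≡ ⟦ d ⟧ * ⟦ e ⟧
⟦⟧-× (yes _) (yes _) = refl
⟦⟧-× (yes _) (no _)  = refl
⟦⟧-× (no _)  _       = refl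

⟦⟧-≤ : (d : Dec P) (e : Dec Q) → (P → Q) → ⟦ d ⟧ ≤ ⟦ e ⟧
⟦⟧-≤ (yes p) e f = ℕ.≤-reflexive (sym (⟦⟧-yes e (f p)))
⟦⟧-≤ (no _)  _ _ = z≤n

length-filter-tabulate : {A : Set p} {P : Pred A q} (P? : Decidable P) (f : Fin n → A) →
                         length (filter P? (tabulate f)) ≡ ∑[ i < n ] ⟦ P? (f i) ⟧
length-filter-tabulate {n = zero}  P? f = refl
length-filter-tabulate {n = suc n} P? f with does (P? (f zero))
... | true  = cong suc (length-filter-tabulate P? (f ∘ suc))
... | false = length-filter-tabulate P? (f ∘ suc)

sum-zero : (φ : Fin n → ℕ) → (∀ i → φ i ≡ 0) → sum φ ≡ 0
sum-zero {zero}  φ h = refl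
sum-zero {suc n} φ h = cong₂ _+_ (h zero) (sum-zero (φ ∘ suc) (h ∘ suc))

sum-single : (φ : Fin n → ℕ) (i : Fin n) → (∀ j → j ≢ i → φ j ≡ 0) → sum φ ≡ φ i
sum-single φ zero h = trans
  (cong (φ zero +_) (sum-zero (φ ∘ suc) λ j → h (suc j) λ ()))
  (ℕ.+-identityʳ _)
sum-single φ (suc i) h = cong₂ _+_ (h zero λ ())
  (sum-single (φ ∘ suc) i λ j j≢i → h (suc j) (j≢i ∘ suc-injective))

sum-mono-≤ : (φ ψ : Fin n → ℕ) → (∀ i → φ i ≤ ψ i) → sum φ ≤ sum ψ
sum-mono-≤ {zero}  φ ψ h = z≤n
sum-mono-≤ {suc n} φ ψ h = ℕ.+-mono-≤ (h zero) (sum-mono-≤ (φ ∘ suc) (ψ ∘ suc) (h ∘ suc))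

sum-mono-< : (φ ψ : Fin n → ℕ) → (∀ i → φ i ≤ ψ i) → ∀ i → φ i < ψ i → sum φ < sum ψ
sum-mono-< φ ψ h zero    lt = ℕ.+-mono-<-≤ lt (sum-mono-≤ (φ ∘ suc) (ψ ∘ suc) (h ∘ suc))
sum-mono-< φ ψ h (suc i) lt =
  ℕ.+-mono-≤-< (h zero) (sum-mono-< (φ ∘ suc) (ψ ∘ suc) (h ∘ suc) i lt)

sum-const : ∀ n c → ∑[ i < n ] c ≡ n * c
sum-const zero    c = refl
sum-const (suc n) c = cong (c +_) (sum-const n c)

∑∑-single : (φ : Fin k → Fin l → ℕ) (i : Fin k) (j : Fin l) →
            (∀ i′ j′ → i′ ≢ i ⊎ j′ ≢ j → φ i′ j′ ≡ 0) →
            ∑[ i′ < k ] ∑[ j′ < l ] φ i′ j′ ≡ φ i j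
∑∑-single φ i j h = trans
  (sum-single (λ i′ → sum (φ i′)) i (λ i′ i′≢i → sum-zero (φ i′) (λ j′ → h i′ j′ (inj₁ i′≢i))))
  (sum-single (φ i) j λ j′ j′≢j → h i j′ (inj₂ j′≢j))

-- Double counting of the triples (x , i , j) with e i j ≡ x.
sum-reindex : (e : Fin k → Fin l → Fin n) (φ : Fin n → ℕ) →
  (∀ {i j i′ j′} → e i j ≡ e i′ j′ → i ≡ i′ × j ≡ j′) →
  (∀ x → φ x ≢ 0 → ∃₂ λ i j → e i j ≡ x) →
  sum φ ≡ ∑[ i < k ] ∑[ j < l ] φ (e i j)
sum-reindex {k} {l} {n} e φ inj cover = begin
  sum φ
    ≡⟨ sum-cong-≗ once ⟩
  ∑[ x < n ] (φ x * ∑[ i < k ] ∑[ j < l ] ⟦ e i j ≟ x ⟧)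
    ≡⟨ sum-cong-≗ (λ x → trans (*-distribˡ-sum (φ x) (λ i → ∑[ j < l ] ⟦ e i j ≟ x ⟧))
         (sum-cong-≗ λ i → *-distribˡ-sum (φ x) (λ j → ⟦ e i j ≟ x ⟧))) ⟩
  ∑[ x < n ] ∑[ i < k ] ∑[ j < l ] (φ x * ⟦ e i j ≟ x ⟧)
    ≡⟨ ∑-comm (λ x i → ∑[ j < l ] (φ x * ⟦ e i j ≟ x ⟧)) ⟩
  ∑[ i < k ] ∑[ x < n ] ∑[ j < l ] (φ x * ⟦ e i j ≟ x ⟧)
    ≡⟨ sum-cong-≗ (λ i → ∑-comm (λ x j → φ x * ⟦ e i j ≟ x ⟧)) ⟩
  ∑[ i < k ] ∑[ j < l ] ∑[ x < n ] (φ x * ⟦ e i j ≟ x ⟧)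
    ≡⟨ sum-cong-≗ (λ i → sum-cong-≗ (kronecker i)) ⟩
  ∑[ i < k ] ∑[ j < l ] φ (e i j) ∎
  where
  open ≡-Reasoning
  kronecker : ∀ i j → ∑[ x < n ] (φ x * ⟦ e i j ≟ x ⟧) ≡ φ (e i j)
  kronecker i j = begin
    ∑[ x < n ] (φ x * ⟦ e i j ≟ x ⟧)
      ≡⟨ sum-single (λ x → φ x * ⟦ e i j ≟ x ⟧) (e i j)
           (λ x x≢ → trans (cong (φ x *_) (⟦⟧-no (e i j ≟ x) (x≢ ∘ sym))) (ℕ.*-zeroʳ (φ x))) ⟩
    φ (e i j) * ⟦ e i j ≟ e i j ⟧
      ≡⟨ cong (φ (e i j) *_) (⟦⟧-yes (e i j ≟ e i j) refl) ⟩
    φ (e i j) * 1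
      ≡⟨ ℕ.*-identityʳ _ ⟩
    φ (e i j) ∎
  once : ∀ x → φ x ≡ φ x * ∑[ i < k ] ∑[ j < l ] ⟦ e i j ≟ x ⟧
  once x with φ x ℕ.≟ 0
  ... | yes φx≡0 = trans φx≡0 (sym (cong (_* _) φx≡0))
  ... | no  φx≢0 with cover x φx≢0
  ...   | i , j , eq = sym (trans (cong (φ x *_) (trans
            (∑∑-single (λ i′ j′ → ⟦ e i′ j′ ≟ x ⟧) i j λ i′ j′ →
               [ (λ ≢i → ⟦⟧-no (e i′ j′ ≟ x) (λ eq′ → ≢i (proj₁ (inj (trans eq′ (sym eq))))))
               , (λ ≢j → ⟦⟧-no (e i′ j′ ≟ x) (λ eq′ → ≢j (proj₂ (inj (trans eq′ (sym eq)))))) ]′)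
            (⟦⟧-yes (e i j ≟ x) eq))) (ℕ.*-identityʳ _))

-- Sums over all maps between two finite sets.

∑maps : ∀ n m → ((Fin n → Fin m) → ℕ) → ℕ
∑maps n m φ = ∑[ i < m ^ n ] φ (finToFun i)

Extensional : ((Fin n → Fin m) → ℕ) → Set
Extensional φ = ∀ {f g} → f ≗ g → φ f ≡ φ g

finToFun-injective : ∀ {n m} {i j : Fin (m ^ n)} →
                     (∀ u → finToFun {m} {n} i u ≡ finToFun j u) → i ≡ j
finToFun-injective {n} {m} {i} {j} h = begin
  i                                 ≡⟨ funToFin-finToFin {n} {m} i ⟨
  funToFin (finToFun {m} {n} i)     ≡⟨ funToFin-cong h ⟩
  funToFin (finToFun {m} {n} j)     ≡⟨ funToFin-finToFin {n} {m} j ⟩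
  j                                 ∎
  where
  open ≡-Reasoning
  funToFin-cong : ∀ {n} {f g : Fin n → Fin m} → f ≗ g → funToFin f ≡ funToFin g
  funToFin-cong {zero}  _ = refl
  funToFin-cong {suc n} e = cong₂ combine (e zero) (funToFin-cong (e ∘ suc))

∑maps-cong : ∀ {n m} {φ ψ : (Fin n → Fin m) → ℕ} → φ ≗ ψ → ∑maps n m φ ≡ ∑maps n m ψ
∑maps-cong h = sum-cong-≗ (λ i → h (finToFun i))

-- `finToFun` lists maps only up to pointwise equality, so `φ` and `E` must respect `≗`. Only maps
-- in the support of `φ` have to arise from `E`, which lets restrictions on the range enter through
-- `φ`.
∑maps-reindex₂ : ∀ {n m a b c d} (E : (Fin a → Fin b) → (Fin c → Fin d) → (Fin n → Fin m))
  (φ : (Fin n → Fin m) → ℕ) → Extensional φ →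
  (∀ {f g f′ g′} → f ≗ f′ → g ≗ g′ → E f g ≗ E f′ g′) →
  (∀ {f g f′ g′} → E f g ≗ E f′ g′ → (f ≗ f′) × (g ≗ g′)) →
  (∀ h → φ h ≢ 0 → ∃₂ λ f g → E f g ≗ h) →
  ∑maps n m φ ≡ ∑maps a b λ f → ∑maps c d λ g → φ (E f g)
∑maps-reindex₂ {n} {m} {a} {b} {c} {d} E φ ext E-cong E-inj cover = trans
  (sum-reindex e (φ ∘ finToFun)
    e-injective
    (λ x φx≢0 → let f , g , eq = cover (finToFun x) φx≢0 in
       funToFin f , funToFin g , finToFun-injective (λ u → trans (to-e _ _ u)
         (trans (E-cong (finToFun-funToFin f) (finToFun-funToFin g) u) (eq u)))))
  (sum-cong-≗ λ i → sum-cong-≗ λ j → ext (to-e i j))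
  where
  e : Fin (b ^ a) → Fin (d ^ c) → Fin (m ^ n)
  e i j = funToFin (E (finToFun i) (finToFun j))
  to-e : ∀ i j → finToFun (e i j) ≗ E (finToFun i) (finToFun j)
  to-e i j = finToFun-funToFin _
  e-injective : ∀ {i j i′ j′} → e i j ≡ e i′ j′ → i ≡ i′ × j ≡ j′
  e-injective {i} {j} {i′} {j′} eq = finToFun-injective (proj₁ fg) , finToFun-injective (proj₂ fg)
    where
    fg : (finToFun i ≗ finToFun i′) × (finToFun j ≗ finToFun j′)
    fg = E-inj λ u → trans (sym (to-e i j u)) (trans (cong (λ x → finToFun x u) eq) (to-e i′ j′ u))

∑maps-reindex : ∀ {n m a b} (E : (Fin a → Fin b) → (Fin n → Fin m))
  (φ : (Fin n → Fin m) → ℕ) → Extensional φ →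
  (∀ {f f′} → f ≗ f′ → E f ≗ E f′) →
  (∀ {f f′} → E f ≗ E f′ → f ≗ f′) →
  (∀ h → φ h ≢ 0 → ∃ λ f → E f ≗ h) →
  ∑maps n m φ ≡ ∑maps a b λ f → φ (E f)
∑maps-reindex {a = a} {b} E φ ext E-cong E-inj cover = trans
  -- There is exactly one map `Fin 0 → Fin 0`, as `0 ^ 0` is `1`, so the inner sum has a single
  -- term.
  (∑maps-reindex₂ {c = 0} {d = 0} (λ f _ → E f) φ ext (λ f≗ _ → E-cong f≗)
    (λ eq → E-inj eq , λ ()) (λ h φh≢0 → let f , eq = cover h φh≢0 in f , (λ ()) , eq))
  (∑maps-cong {a} {b} λ f → ℕ.+-identityʳ (φ (E f)))

∑maps-* : ∀ {a b c d} (φ : (Fin a → Fin b) → ℕ) (ψ : (Fin c → Fin d) → ℕ) →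
          ∑maps a b φ * ∑maps c d ψ ≡ ∑maps a b λ f → ∑maps c d λ g → φ f * ψ g
∑maps-* φ ψ = trans (*-distribʳ-sum _ (φ ∘ finToFun))
  (sum-cong-≗ λ i → *-distribˡ-sum (φ (finToFun i)) (ψ ∘ finToFun))

∑maps-combine : ∀ {n a b} (φ : (Fin n → Fin (a * b)) → ℕ) → Extensional φ →
  ∑maps n (a * b) φ ≡ ∑maps n a λ g → ∑maps n b λ h → φ (λ u → combine (g u) (h u))
∑maps-combine {n} {a} {b} φ ext = ∑maps-reindex₂ (λ g h u → combine (g u) (h u)) φ ext
  (λ g≗ h≗ u → cong₂ combine (g≗ u) (h≗ u))
  (λ {g} {h} {g′} {h′} eq →
      (λ u → proj₁ (combine-injective (g u) (h u) (g′ u) (h′ u) (eq u)))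
    , (λ u → proj₂ (combine-injective (g u) (h u) (g′ u) (h′ u) (eq u))))
  (λ f _ → proj₁ ∘ remQuot b ∘ f , proj₂ ∘ remQuot {a} b ∘ f , combine-remQuot {a} b ∘ f)

-- Graph constructions, isomorphism invariance and disjoint unions.

infixl 6 _↾_ _∣_
infixl 7 _⊗_

_↾_ : (F : SimpleGraph) → (Fin k → V F) → SimpleGraph
_↾_ {k} F e = record
  { order    = k
  ; Adj      = λ i j → Adj F (e i) (e j)
  ; adj?     = λ i j → adj? F (e i) (e j)
  ; adj-sym  = adj-sym F
  ; loopless = λ { refl → loopless F refl }
  }

_∣_ : (F : SimpleGraph) → (V F → Fin k) → SimpleGraph
F ∣ g = record
  { order    = order F
  ; Adj      = λ u v → Adj F u v × g u ≡ g v
  ; adj?     = λ u v → adj? F u v ×-dec g u ≟ g v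
  ; adj-sym  = λ (uv , eq) → adj-sym F uv , sym eq
  ; loopless = λ eq (uv , _) → loopless F eq uv
  }

complete : ℕ → SimpleGraph
complete n = record
  { order    = n
  ; Adj      = _≢_
  ; adj?     = λ i j → ¬? (i ≟ j)
  ; adj-sym  = λ i≢j → i≢j ∘ sym
  ; loopless = λ eq i≢j → i≢j eq
  }

_⊗_ : SimpleGraph → SimpleGraph → SimpleGraph
T ⊗ H = record
  { order    = order T * order H
  ; Adj      = λ x y → Adj⊗ (remQuot (order H) x) (remQuot (order H) y)
  ; adj?     = λ x y → let t , h = remQuot (order H) x
                           t′ , h′ = remQuot (order H) y
                       in adj? T t t′ ×-dec adj? H h h′
  ; adj-sym  = λ (tt′ , hh′) → adj-sym T tt′ , adj-sym H hh′
  ; loopless = λ { refl (t~t , _) → loopless T refl t~t }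
  }
  where
  Adj⊗ : V T × V H → V T × V H → Set
  Adj⊗ (t , h) (t′ , h′) = Adj T t t′ × Adj H h h′

IsHom-resp-≗ : ∀ F G {f g : V F → V G} → f ≗ g → IsHom F G f → IsHom F G g
IsHom-resp-≗ F G f≗g h u v uv = subst₂ (Adj G) (f≗g u) (f≗g v) (h u v uv)

isHom?-ext : ∀ F G → Extensional (λ f → ⟦ isHom? F G f ⟧)
isHom?-ext F G {f} {g} f≗g = ⟦⟧-cong (isHom? F G f) (isHom? F G g)
  (IsHom-resp-≗ F G f≗g) (IsHom-resp-≗ F G (sym ∘ f≗g))

hom-∑ : ∀ F G → hom F G ≡ ∑maps (order F) (order G) λ f → ⟦ isHom? F G f ⟧
hom-∑ F G = length-filter-tabulate (λ i → isHom? F G (finToFun i)) id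

hom-iso : ∀ L L′ H (f : V L → V L′) (s : V L′ → V L) → f ∘ s ≗ id → s ∘ f ≗ id →
          (∀ u v → Adj L u v ⇔ Adj L′ (f u) (f v)) → hom L H ≡ hom L′ H
hom-iso L L′ H f s fs≗id sf≗id f-adj = begin
  hom L H
    ≡⟨ hom-∑ L H ⟩
  (∑maps (order L) (order H) λ h → ⟦ isHom? L H h ⟧)
    ≡⟨ ∑maps-reindex (_∘ f) (λ h → ⟦ isHom? L H h ⟧) (isHom?-ext L H) (λ eq → eq ∘ f)
         (λ {h} {h′} eq u → trans (cong h (sym (fs≗id u))) (trans (eq (s u)) (cong h′ (fs≗id u))))
         (λ h _ → h ∘ s , cong h ∘ sf≗id) ⟩
  (∑maps (order L′) (order H) λ h → ⟦ isHom? L H (h ∘ f) ⟧)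
    ≡⟨ ∑maps-cong (λ h → ⟦⟧-cong (isHom? L H (h ∘ f)) (isHom? L′ H h) (pull h) (push h)) ⟩
  (∑maps (order L′) (order H) λ h → ⟦ isHom? L′ H h ⟧)
    ≡⟨ hom-∑ L′ H ⟨
  hom L′ H ∎
  where
  open ≡-Reasoning
  pull : ∀ h → IsHom L H (h ∘ f) → IsHom L′ H h
  pull h h-hom u v uv = subst₂ (λ u v → Adj H (h u) (h v)) (fs≗id u) (fs≗id v)
    (h-hom (s u) (s v) (Equivalence.from (f-adj (s u) (s v))
      (subst₂ (Adj L′) (sym (fs≗id u)) (sym (fs≗id v)) uv)))
  push : ∀ h → IsHom L′ H h → IsHom L H (h ∘ f)
  push h h-hom u v uv = h-hom (f u) (f v) (Equivalence.to (f-adj u v) uv)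

module _ (L H : SimpleGraph) (e₁ : Fin k → V L) (e₂ : Fin l → V L)
  (e₁-inj : Injective _≡_ _≡_ e₁) (e₂-inj : Injective _≡_ _≡_ e₂)
  (disjoint : ∀ i j → e₁ i ≢ e₂ j)
  (cover : ∀ u → (∃ λ i → e₁ i ≡ u) ⊎ (∃ λ j → e₂ j ≡ u))
  where

  private
    glue : {A : Set} (f : Fin k → A) (g : Fin l → A) → V L → A
    glue f g u = [ f ∘ proj₁ , g ∘ proj₁ ]′ (cover u)

    glue-e₁ : {A : Set} (f : Fin k → A) (g : Fin l → A) → glue f g ∘ e₁ ≗ f
    glue-e₁ f g i with cover (e₁ i)
    ... | inj₁ (i′ , eq) = cong f (e₁-inj eq)
    ... | inj₂ (j , eq)  = contradiction (sym eq) (disjoint i j)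

    glue-e₂ : {A : Set} (f : Fin k → A) (g : Fin l → A) → glue f g ∘ e₂ ≗ g
    glue-e₂ f g j with cover (e₂ j)
    ... | inj₁ (i , eq)  = contradiction eq (disjoint i j)
    ... | inj₂ (j′ , eq) = cong g (e₂-inj eq)

    glue-unique : {A : Set} (f : Fin k → A) (g : Fin l → A) (h : V L → A) →
                  f ≗ h ∘ e₁ → g ≗ h ∘ e₂ → glue f g ≗ h
    glue-unique f g h f≗ g≗ u with cover u
    ... | inj₁ (i , eq) = trans (f≗ i) (cong h eq)
    ... | inj₂ (j , eq) = trans (g≗ j) (cong h eq)

  -- Maps on `V L` correspond to pairs of maps on the two parts through `glue`. Without edges
  -- between the parts, the homomorphism condition is checked on each part separately.
  hom-disjoint : (∀ i j → ¬ Adj L (e₁ i) (e₂ j)) →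
                 hom L H ≡ hom (L ↾ e₁) H * hom (L ↾ e₂) H
  hom-disjoint no-edge = begin
    hom L H
      ≡⟨ hom-∑ L H ⟩
    (∑maps (order L) (order H) λ h → ⟦ isHom? L H h ⟧)
      ≡⟨ ∑maps-reindex₂ glue (λ h → ⟦ isHom? L H h ⟧) (isHom?-ext L H)
           (λ {f} {g} {f′} {g′} f≗ g≗ → glue-unique f g (glue f′ g′)
              (λ i → trans (f≗ i) (sym (glue-e₁ f′ g′ i)))
              (λ j → trans (g≗ j) (sym (glue-e₂ f′ g′ j))))
           (λ {f} {g} {f′} {g′} eq →
              (λ i → trans (sym (glue-e₁ f g i)) (trans (eq (e₁ i)) (glue-e₁ f′ g′ i)))
            , (λ j → trans (sym (glue-e₂ f g j)) (trans (eq (e₂ j)) (glue-e₂ f′ g′ j))))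
           (λ h _ → h ∘ e₁ , h ∘ e₂ , glue-unique (h ∘ e₁) (h ∘ e₂) h (λ _ → refl) (λ _ → refl)) ⟩
    (∑maps k (order H) λ f → ∑maps l (order H) λ g → ⟦ isHom? L H (glue f g) ⟧)
      ≡⟨ ∑maps-cong (λ f → ∑maps-cong λ g → trans
           (⟦⟧-cong (isHom? L H (glue f g)) (isHom? (L ↾ e₁) H f ×-dec isHom? (L ↾ e₂) H g)
             (split f g) (join f g))
           (⟦⟧-× (isHom? (L ↾ e₁) H f) (isHom? (L ↾ e₂) H g))) ⟩
    (∑maps k (order H) λ f → ∑maps l (order H) λ g →
       ⟦ isHom? (L ↾ e₁) H f ⟧ * ⟦ isHom? (L ↾ e₂) H g ⟧)
      ≡⟨ ∑maps-* (λ f → ⟦ isHom? (L ↾ e₁) H f ⟧) (λ g → ⟦ isHom? (L ↾ e₂) H g ⟧) ⟨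
    (∑maps k (order H) λ f → ⟦ isHom? (L ↾ e₁) H f ⟧)
      * (∑maps l (order H) λ g → ⟦ isHom? (L ↾ e₂) H g ⟧)
      ≡⟨ cong₂ _*_ (hom-∑ (L ↾ e₁) H) (hom-∑ (L ↾ e₂) H) ⟨
    hom (L ↾ e₁) H * hom (L ↾ e₂) H ∎
    where
    open ≡-Reasoning
    split : ∀ f g → IsHom L H (glue f g) → IsHom (L ↾ e₁) H f × IsHom (L ↾ e₂) H g
    split f g h-hom =
        IsHom-resp-≗ (L ↾ e₁) H (glue-e₁ f g) (λ i i′ → h-hom (e₁ i) (e₁ i′))
      , IsHom-resp-≗ (L ↾ e₂) H (glue-e₂ f g) (λ j j′ → h-hom (e₂ j) (e₂ j′))
    join : ∀ f g → IsHom (L ↾ e₁) H f × IsHom (L ↾ e₂) H g → IsHom L H (glue f g)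
    join f g (f-hom , g-hom) u v uv with cover u | cover v
    ... | inj₁ (i , refl) | inj₁ (i′ , refl) = f-hom i i′ uv
    ... | inj₂ (j , refl) | inj₂ (j′ , refl) = g-hom j j′ uv
    ... | inj₁ (i , refl) | inj₂ (j , refl)  = contradiction uv (no-edge i j)
    ... | inj₂ (j , refl) | inj₁ (i , refl)  = contradiction (adj-sym L uv) (no-edge i j)

-- Homomorphisms into lexicographic and tensor products.

on-remQuot-combine : ∀ {m n} (_~_ : Fin m × Fin n → Fin m × Fin n → Set) i j i′ j′ →
  (remQuot n (combine i j) ~ remQuot n (combine i′ j′)) ≡ ((i , j) ~ (i′ , j′))
on-remQuot-combine _~_ i j i′ j′ = cong₂ _~_ (remQuot-combine i j) (remQuot-combine i′ j′)

-- The condition on the first coordinate of a homomorphism into `G · H`: a homomorphism to `G` with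
-- a loop added at every vertex.
EdgesToEdgesOrPoints : ∀ F G → (V F → V G) → Set
EdgesToEdgesOrPoints F G g = ∀ u v → Adj F u v → g u ≡ g v ⊎ Adj G (g u) (g v)

edgesToEdgesOrPoints? : ∀ F G g → Dec (EdgesToEdgesOrPoints F G g)
edgesToEdgesOrPoints? F G g =
  all? λ u → all? λ v → adj? F u v →-dec (g u ≟ g v ⊎-dec adj? G (g u) (g v))

-- A map into `G · H` is a pair `g`, `h`. An edge of `F` between two fibres of `g` must go to an
-- edge of `G` and then leaves `h` free; an edge inside a fibre has to be preserved by `h`, because
-- `G` has no loop to absorb it.
hom-lex : ∀ F G H → hom F (G · H) ≡
  ∑maps (order F) (order G) λ g → ⟦ edgesToEdgesOrPoints? F G g ⟧ * hom (F ∣ g) H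
hom-lex F G H = begin
  hom F (G · H)
    ≡⟨ hom-∑ F (G · H) ⟩
  (∑maps (order F) (order G * order H) λ f → ⟦ isHom? F (G · H) f ⟧)
    ≡⟨ ∑maps-combine (λ f → ⟦ isHom? F (G · H) f ⟧) (isHom?-ext F (G · H)) ⟩
  (∑maps (order F) (order G) λ g → ∑maps (order F) (order H) λ h →
     ⟦ isHom? F (G · H) (λ u → combine (g u) (h u)) ⟧)
    ≡⟨ ∑maps-cong (λ g → ∑maps-cong (λ h → trans
         (⟦⟧-cong (isHom? F (G · H) (λ u → combine (g u) (h u)))
           (edgesToEdgesOrPoints? F G g ×-dec isHom? (F ∣ g) H h) (split g h) (join g h))
         (⟦⟧-× (edgesToEdgesOrPoints? F G g) (isHom? (F ∣ g) H h)))) ⟩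
  (∑maps (order F) (order G) λ g → ∑maps (order F) (order H) λ h →
     ⟦ edgesToEdgesOrPoints? F G g ⟧ * ⟦ isHom? (F ∣ g) H h ⟧)
    ≡⟨ ∑maps-cong (λ g → trans
         (cong (⟦ edgesToEdgesOrPoints? F G g ⟧ *_) (hom-∑ (F ∣ g) H))
         (*-distribˡ-sum ⟦ edgesToEdgesOrPoints? F G g ⟧
           (λ i → ⟦ isHom? (F ∣ g) H (finToFun i) ⟧))) ⟨
  (∑maps (order F) (order G) λ g → ⟦ edgesToEdgesOrPoints? F G g ⟧ * hom (F ∣ g) H) ∎
  where
  open ≡-Reasoning
  Adj-lex : ∀ g h u v → Adj (G · H) (combine (g u) (h u)) (combine (g v) (h v))
                      ≡ LexAdj G H (g u , h u) (g v , h v)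
  Adj-lex g h u v = on-remQuot-combine (LexAdj G H) (g u) (h u) (g v) (h v)
  split : ∀ g h → IsHom F (G · H) (λ u → combine (g u) (h u)) →
          EdgesToEdgesOrPoints F G g × IsHom (F ∣ g) H h
  split g h gh-hom =
      (λ u v uv → [ inj₁ ∘ proj₁ , inj₂ ]′ (subst id (Adj-lex g h u v) (gh-hom u v uv)))
    , (λ u v (uv , gu≡gv) →
         [ proj₂ , (λ gugv → ⊥-elim (loopless G gu≡gv gugv)) ]′
           (subst id (Adj-lex g h u v) (gh-hom u v uv)))
  join : ∀ g h → EdgesToEdgesOrPoints F G g × IsHom (F ∣ g) H h →
         IsHom F (G · H) (λ u → combine (g u) (h u))
  join g h (g-ok , h-hom) u v uv = subst id (sym (Adj-lex g h u v))
    ([ (λ gu≡gv → inj₁ (gu≡gv , h-hom u v (uv , gu≡gv))) , inj₂ ]′ (g-ok u v uv))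

hom-⊗ : ∀ F T H → hom F (T ⊗ H) ≡ hom F T * hom F H
hom-⊗ F T H = begin
  hom F (T ⊗ H)
    ≡⟨ hom-∑ F (T ⊗ H) ⟩
  (∑maps (order F) (order T * order H) λ f → ⟦ isHom? F (T ⊗ H) f ⟧)
    ≡⟨ ∑maps-combine (λ f → ⟦ isHom? F (T ⊗ H) f ⟧) (isHom?-ext F (T ⊗ H)) ⟩
  (∑maps (order F) (order T) λ g → ∑maps (order F) (order H) λ h →
     ⟦ isHom? F (T ⊗ H) (λ u → combine (g u) (h u)) ⟧)
    ≡⟨ ∑maps-cong (λ g → ∑maps-cong (λ h → trans
         (⟦⟧-cong (isHom? F (T ⊗ H) (λ u → combine (g u) (h u)))
           (isHom? F T g ×-dec isHom? F H h) (split g h) (join g h))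
         (⟦⟧-× (isHom? F T g) (isHom? F H h)))) ⟩
  (∑maps (order F) (order T) λ g → ∑maps (order F) (order H) λ h →
     ⟦ isHom? F T g ⟧ * ⟦ isHom? F H h ⟧)
    ≡⟨ ∑maps-* (λ g → ⟦ isHom? F T g ⟧) (λ h → ⟦ isHom? F H h ⟧) ⟨
  (∑maps (order F) (order T) λ g → ⟦ isHom? F T g ⟧)
    * (∑maps (order F) (order H) λ h → ⟦ isHom? F H h ⟧)
    ≡⟨ cong₂ _*_ (hom-∑ F T) (hom-∑ F H) ⟨
  hom F T * hom F H ∎
  where
  open ≡-Reasoning
  Adj-⊗ : ∀ g h u v → Adj (T ⊗ H) (combine (g u) (h u)) (combine (g v) (h v))
                    ≡ (Adj T (g u) (g v) × Adj H (h u) (h v))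
  Adj-⊗ g h u v = on-remQuot-combine (λ (t , h) (t′ , h′) → Adj T t t′ × Adj H h h′)
    (g u) (h u) (g v) (h v)
  split : ∀ g h → IsHom F (T ⊗ H) (λ u → combine (g u) (h u)) → IsHom F T g × IsHom F H h
  split g h gh-hom =
      (λ u v uv → proj₁ (subst id (Adj-⊗ g h u v) (gh-hom u v uv)))
    , (λ u v uv → proj₂ (subst id (Adj-⊗ g h u v) (gh-hom u v uv)))
  join : ∀ g h → IsHom F T g × IsHom F H h → IsHom F (T ⊗ H) (λ u → combine (g u) (h u))
  join g h (g-hom , h-hom) u v uv = subst id (sym (Adj-⊗ g h u v)) (g-hom u v uv , h-hom u v uv)

-- Vertex subsets, induced subgraphs and fibres of colourings.

record Enumeration {n} (P : Pred (Fin n) 0ℓ) : Set where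
  field
    size           : ℕ
    elem           : Fin size → Fin n
    elem-injective : Injective _≡_ _≡_ elem
    elem-∈         : ∀ i → P (elem i)
    index          : ∀ u → P u → ∃ λ i → elem i ≡ u

open Enumeration

enumerate : {P : Pred (Fin n) 0ℓ} → Decidable P → Enumeration P
enumerate {zero}  P? = record
  { size = 0 ; elem = id ; elem-injective = id ; elem-∈ = λ () ; index = λ () }
enumerate {suc n} {P} P? with P? zero | enumerate (P? ∘ suc)
... | no ¬p | E = record
  { size           = size E
  ; elem           = suc ∘ elem E
  ; elem-injective = elem-injective E ∘ suc-injective
  ; elem-∈         = elem-∈ E
  ; index          = λ where
      zero    pu → contradiction pu ¬p
      (suc u) pu → let i , eq = index E u pu in i , cong suc eq
  }
... | yes p | E = record
  { size           = suc (size E)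
  ; elem           = elem′
  ; elem-injective = elem′-injective
  ; elem-∈         = λ where
      zero    → p
      (suc i) → elem-∈ E i
  ; index          = λ where
      zero    _  → zero , refl
      (suc u) pu → let i , eq = index E u pu in suc i , cong suc eq
  }
  where
  elem′ : Fin (suc (size E)) → Fin (suc n)
  elem′ zero    = zero
  elem′ (suc i) = suc (elem E i)
  elem′-injective : Injective _≡_ _≡_ elem′
  elem′-injective {zero}  {zero}  _  = refl
  elem′-injective {suc i} {suc j} eq = cong suc (elem-injective E (suc-injective eq))

IsInducedSubgraph-trans : ∀ {F G H} → IsInducedSubgraph F G → IsInducedSubgraph G H →
                          IsInducedSubgraph F H
IsInducedSubgraph-trans (f , f-inj , f-adj) (g , g-inj , g-adj) =
    g ∘ f
  , f-inj ∘ g-inj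
  , λ u v → mk⇔ (Equivalence.to (g-adj (f u) (f v)) ∘ Equivalence.to (f-adj u v))
                (Equivalence.from (f-adj u v) ∘ Equivalence.from (g-adj (f u) (f v)))

-- Induction on the number of colours: no edge of `F ∣ g` leaves the fibre over `zero`, so the count
-- splits into a factor for this fibre, an induced subgraph of `F`, and a factor for the other
-- vertices, which use one colour fewer.
hom-∣-cong : ∀ k F (g : V F → Fin k) H H′ →
  (∀ K → IsInducedSubgraph K F → hom K H ≡ hom K H′) →
  hom (F ∣ g) H ≡ hom (F ∣ g) H′
hom-∣-cong zero F g H H′ h = h (F ∣ g)
  (id , id , λ u _ → mk⇔ proj₁ (λ _ → contradiction (g u) λ ()))
hom-∣-cong (suc k) F g H H′ h = begin
  hom (F ∣ g) H                                    ≡⟨ split H ⟩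
  hom (F ∣ g ↾ e₁) H * hom (F ∣ g ↾ e₂) H          ≡⟨ cong₂ _*_ (h (F ∣ g ↾ e₁) fibre) rest ⟩
  hom (F ∣ g ↾ e₁) H′ * hom (F ∣ g ↾ e₂) H′        ≡⟨ split H′ ⟨
  hom (F ∣ g) H′ ∎
  where
  open ≡-Reasoning
  E₁ = enumerate (λ u → g u ≟ zero)
  E₂ = enumerate (λ u → ¬? (g u ≟ zero))
  e₁ = elem E₁
  e₂ = elem E₂
  split : ∀ H → hom (F ∣ g) H ≡ hom (F ∣ g ↾ e₁) H * hom (F ∣ g ↾ e₂) H
  split H = hom-disjoint (F ∣ g) H e₁ e₂ (elem-injective E₁) (elem-injective E₂)
    (λ i j eq → elem-∈ E₂ j (trans (cong g (sym eq)) (elem-∈ E₁ i)))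
    cover
    (λ i j (_ , eq) → elem-∈ E₂ j (trans (sym eq) (elem-∈ E₁ i)))
    where
    cover : ∀ u → (∃ λ i → e₁ i ≡ u) ⊎ (∃ λ j → e₂ j ≡ u)
    cover u with g u ≟ zero
    ... | yes gu≡0 = inj₁ (index E₁ u gu≡0)
    ... | no  gu≢0 = inj₂ (index E₂ u gu≢0)
  -- All colours agree on this fibre, so `∣ g` deletes no edge inside it.
  fibre : IsInducedSubgraph (F ∣ g ↾ e₁) F
  fibre = e₁ , elem-injective E₁ ,
    λ i j → mk⇔ proj₁ (λ ij → ij , trans (elem-∈ E₁ i) (sym (elem-∈ E₁ j)))
  0≢ : ∀ j → zero ≢ g (e₂ j)
  0≢ j = elem-∈ E₂ j ∘ sym
  -- Dropping the colour `zero` renumbers the others injectively, so `g′` has the same fibres as `g`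
  -- on these vertices.
  g′ : Fin (size E₂) → Fin k
  g′ j = punchOut (0≢ j)
  same : ∀ H → hom (F ∣ g ↾ e₂) H ≡ hom (F ↾ e₂ ∣ g′) H
  same H = hom-iso (F ∣ g ↾ e₂) (F ↾ e₂ ∣ g′) H id id (λ _ → refl) (λ _ → refl)
    λ i j → mk⇔ (λ (ij , eq) → ij , punchOut-cong zero {i≢j = 0≢ i} {i≢k = 0≢ j} eq)
                (λ (ij , eq) → ij , punchOut-injective (0≢ i) (0≢ j) eq)
  rest : hom (F ∣ g ↾ e₂) H ≡ hom (F ∣ g ↾ e₂) H′
  rest = trans (same H) (trans
    (hom-∣-cong k (F ↾ e₂) g′ H H′ λ K K⊆ → h K (IsInducedSubgraph-trans {K} {F ↾ e₂} {F} K⊆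
      (e₂ , elem-injective E₂ , λ _ _ → mk⇔ id id)))
    (sym (same H′)))

-- In `hom-lex` only the factors `hom (F ∣ g) H` involve the second graph, and they are determined
-- by counts of induced subgraphs of `F`, which lie in `𝓕`.
closed⇒preserved : ∀ {ℓ} (𝓕 : Pred SimpleGraph ℓ) →
                   ClosedUnderInducedSubgraphs 𝓕 → PreservedUnderLeftLex 𝓕
closed⇒preserved 𝓕 closed G H H′ H≡H′ F F∈𝓕 = begin
  hom F (G · H)
    ≡⟨ hom-lex F G H ⟩
  (∑maps (order F) (order G) λ g → ⟦ edgesToEdgesOrPoints? F G g ⟧ * hom (F ∣ g) H)
    ≡⟨ ∑maps-cong (λ g → cong (⟦ edgesToEdgesOrPoints? F G g ⟧ *_)
         (hom-∣-cong (order G) F g H H′ λ K K⊆F → H≡H′ K (closed F K F∈𝓕 K⊆F))) ⟩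
  (∑maps (order F) (order G) λ g → ⟦ edgesToEdgesOrPoints? F G g ⟧ * hom (F ∣ g) H′)
    ≡⟨ hom-lex F G H′ ⟨
  hom F (G · H′) ∎
  where open ≡-Reasoning

-- Covering and surjective homomorphisms.

⟦⟧-⊎ : (d : Dec P) (e : Dec Q) (r : Dec R) → (P → R) → (Q → R) → (R → P ⊎ Q) → (P → ¬ Q) →
       ⟦ d ⟧ + ⟦ e ⟧ ≡ ⟦ r ⟧
⟦⟧-⊎ (yes p) (yes q) _ _ _ _ h = contradiction q (h p)
⟦⟧-⊎ (yes p) (no _)  r f _ _ _ = sym (⟦⟧-yes r (f p))
⟦⟧-⊎ (no _)  (yes q) r _ g _ _ = sym (⟦⟧-yes r (g q))
⟦⟧-⊎ (no ¬p) (no ¬q) r _ _ h _ = sym (⟦⟧-no r ([ ¬p , ¬q ]′ ∘ h))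

sum≢0⇒∃ : (φ : Fin n → ℕ) → sum φ ≢ 0 → ∃ λ i → φ i ≢ 0
sum≢0⇒∃ {n} φ h with any? (λ i → ¬? (φ i ℕ.≟ 0))
... | yes ∃i = ∃i
... | no ∄i  = contradiction (sum-zero φ λ i → decidable-stable (φ i ℕ.≟ 0) (λ φi≢0 → ∄i (i , φi≢0))) h

sum-positive : (φ : Fin n → ℕ) (i : Fin n) → 0 < φ i → 0 < sum φ
sum-positive {n} φ i 0<φi = subst (_< sum φ) (sum-zero {n} (const 0) (λ _ → refl))
  (sum-mono-< (const 0) φ (λ _ → z≤n) i 0<φi)

Hits : (Fin n → Fin m) → Pred (Fin m) 0ℓ
Hits f v = ∃ λ u → f u ≡ v

hits? : (f : Fin n → Fin m) → Decidable (Hits f)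
hits? f v = any? λ u → f u ≟ v

-- Interpolates between two notions: with `vs` empty, homomorphisms into the subgraph of `T` induced
-- by `P`; with `P` universal and `vs` all of `V T`, homomorphisms surjective on vertices.
IsCoveringHom : ∀ F T → Pred (V T) 0ℓ → List (V T) → Pred (V F → V T) 0ℓ
IsCoveringHom F T P vs f = IsHom F T f × (∀ u → P (f u)) × All (Hits f) vs

isCoveringHom? : ∀ F T {P : Pred (V T) 0ℓ} → Decidable P → ∀ vs → Decidable (IsCoveringHom F T P vs)
isCoveringHom? F T P? vs f = isHom? F T f ×-dec all? (P? ∘ f) ×-dec All.all? (hits? f) vs

coveringHoms : ∀ F T {P : Pred (V T) 0ℓ} → Decidable P → List (V T) → ℕ
coveringHoms F T P? vs = ∑maps (order F) (order T) λ f → ⟦ isCoveringHom? F T P? vs f ⟧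

-- Maps with all values in `P` factor uniquely through the injection enumerating `P`. This is the
-- base case of inclusion-exclusion.
coveringHoms-[] : ∀ F T {P : Pred (V T) 0ℓ} (P? : Decidable P) →
                  coveringHoms F T P? [] ≡ hom F (T ↾ elem (enumerate P?))
coveringHoms-[] F T {P} P? = begin
  coveringHoms F T P? []
    ≡⟨ ∑maps-reindex (e ∘_) (λ f → ⟦ isCoveringHom? F T P? [] f ⟧)
         (λ {f} {g} f≗g → ⟦⟧-cong (isCoveringHom? F T P? [] f) (isCoveringHom? F T P? [] g)
            (resp f≗g) (resp (sym ∘ f≗g)))
         (λ f≗g u → cong e (f≗g u))
         (λ ef≗eg u → elem-injective E (ef≗eg u))
         (λ f h → let _ , f∈P , _ = ⟦⟧≢0 (isCoveringHom? F T P? [] f) h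
                  in (λ u → proj₁ (index E (f u) (f∈P u))) , (λ u → proj₂ (index E (f u) (f∈P u)))) ⟩
  (∑maps (order F) (size E) λ f → ⟦ isCoveringHom? F T P? [] (e ∘ f) ⟧)
    ≡⟨ ∑maps-cong (λ f → ⟦⟧-cong (isCoveringHom? F T P? [] (e ∘ f)) (isHom? F (T ↾ e) f)
         proj₁ (λ f-hom → f-hom , elem-∈ E ∘ f , [])) ⟩
  (∑maps (order F) (size E) λ f → ⟦ isHom? F (T ↾ e) f ⟧)
    ≡⟨ hom-∑ F (T ↾ e) ⟨
  hom F (T ↾ e) ∎
  where
  open ≡-Reasoning
  E = enumerate P?
  e = elem E
  resp : ∀ {f g} → f ≗ g → IsCoveringHom F T P [] f → IsCoveringHom F T P [] g
  resp f≗g (f-hom , f∈P , []) = IsHom-resp-≗ F T f≗g f-hom , (λ u → subst P (f≗g u) (f∈P u)) , []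

-- A homomorphism either hits `v` or stays within `P` minus `v`. Written as a sum, the
-- inclusion-exclusion step avoids truncated subtraction.
coveringHoms-∷ : ∀ F T {P : Pred (V T) 0ℓ} (P? : Decidable P) v vs →
  coveringHoms F T P? (v ∷ vs) + coveringHoms F T (λ x → P? x ×-dec ¬? (x ≟ v)) vs
    ≡ coveringHoms F T P? vs
coveringHoms-∷ F T {P} P? v vs = trans
  (sym (∑-distrib-+ (λ i → ⟦ isCoveringHom? F T P? (v ∷ vs) (finToFun i) ⟧)
                    (λ i → ⟦ isCoveringHom? F T P′? vs (finToFun i) ⟧)))
  (∑maps-cong λ f → ⟦⟧-⊎ (isCoveringHom? F T P? (v ∷ vs) f) (isCoveringHom? F T P′? vs f)
    (isCoveringHom? F T P? vs f)
    (λ { (f-hom , f∈P , _ ∷ hits) → f-hom , f∈P , hits })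
    (λ (f-hom , f∈P , hits) → f-hom , proj₁ ∘ f∈P , hits)
    (split f)
    (λ { (_ , _ , (u , fu≡v) ∷ _) (_ , f∈P , _) → proj₂ (f∈P u) fu≡v }))
  where
  P′? = λ x → P? x ×-dec ¬? (x ≟ v)
  split : ∀ f → IsCoveringHom F T P vs f →
          IsCoveringHom F T P (v ∷ vs) f ⊎ IsCoveringHom F T (λ x → P x × x ≢ v) vs f
  split f (f-hom , f∈P , hits) with hits? f v
  ... | yes hit = inj₁ (f-hom , f∈P , hit ∷ hits)
  ... | no miss = inj₂ (f-hom , (λ u → f∈P u , λ fu≡v → miss (u , fu≡v)) , hits)

surjectiveHoms : SimpleGraph → SimpleGraph → ℕ
surjectiveHoms F T = coveringHoms F T U? (allFin (order T))

surjectiveHoms≢0⇒∃ : ∀ F T → surjectiveHoms F T ≢ 0 → ∃ λ f → IsHom F T f × (∀ v → Hits f v)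
surjectiveHoms≢0⇒∃ F T h =
  let i , φi≢0          = sum≢0⇒∃ (λ i → ⟦ covering? (finToFun i) ⟧) h
      f-hom , _ , hits = ⟦⟧≢0 (covering? (finToFun i)) φi≢0
  in finToFun i , f-hom , λ v → All.lookup hits (∈-allFin v)
  where covering? = isCoveringHom? F T U? (allFin (order T))

surjectiveHoms-positive : ∀ T → 0 < surjectiveHoms T T
surjectiveHoms-positive T = sum-positive (λ i → ⟦ covering? (finToFun i) ⟧) identity
  (ℕ.≤-reflexive (sym (⟦⟧-yes (covering? (finToFun identity))
    ( (λ u v → subst₂ (Adj T) (sym (f≗id u)) (sym (f≗id v)))
    , (λ _ → tt)
    , All.universal (λ v → v , f≗id v) (allFin (order T))))))
  where
  covering? = isCoveringHom? T T U? (allFin (order T))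
  identity = funToFin {order T} id
  f≗id : finToFun identity ≗ id
  f≗id = finToFun-funToFin {order T} id

-- Pigeonhole: if `s (f u)` differs from `u`, then `s` misses `u`, since `u ≡ s x` would give
-- `f u ≡ x`. But `s` is injective, so `punchOut` would inject `suc n` points into `n`.
rightInverse⇒leftInverse : (f s : Fin n → Fin n) → f ∘ s ≗ id → s ∘ f ≗ id
rightInverse⇒leftInverse {suc n} f s fs≗id u with s (f u) ≟ u
... | yes eq = eq
... | no  ≢u = contradiction (injective⇒≤ {f = λ x → punchOut (missed x)}
                 (λ eq → s-injective (punchOut-injective (missed _) (missed _) eq))) ℕ.1+n≰n
  where
  missed : ∀ x → u ≢ s x
  missed x u≡sx = ≢u (trans (cong s (trans (cong f u≡sx) (fs≗id x))) (sym u≡sx))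
  s-injective : Injective _≡_ _≡_ s
  s-injective {x} {y} eq = trans (sym (fs≗id x)) (trans (cong f eq) (fs≗id y))

-- Twice the number of edges, as each is counted in both directions.
adjacentPairs : SimpleGraph → ℕ
adjacentPairs L = ∑[ u < order L ] ∑[ v < order L ] ⟦ adj? L u v ⟧

-- Equal orders make `f` a bijection. If it sends some non-adjacent pair to an adjacent one, `L′`
-- has more adjacent pairs; otherwise `f` reflects edges and is an isomorphism.
surjective-hom⇒smaller-or-iso : ∀ L L′ → order L ≡ order L′ → (f : V L → V L′) → IsHom L L′ f →
  (∀ v → Hits f v) → adjacentPairs L < adjacentPairs L′ ⊎ (∀ H → hom L H ≡ hom L′ H)
surjective-hom⇒smaller-or-iso L@record{ order = n } L′ refl f f-hom f-surj
  with any? (λ u → any? λ v → ¬? (adj? L u v) ×-dec adj? L′ (f u) (f v))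
... | yes (u , v , ¬uv , fufv) = inj₁ (subst (adjacentPairs L <_) (sym reindex)
        (sum-mono-< _ _ (λ u → sum-mono-≤ _ _ (pointwise u)) u
          (sum-mono-< _ _ (pointwise u) v
            (subst₂ _<_ (sym (⟦⟧-no (adj? L u v) ¬uv)) (sym (⟦⟧-yes (adj? L′ (f u) (f v)) fufv)) ℕ.0<1+n))))
  where
  s = proj₁ ∘ f-surj
  fs≗id : f ∘ s ≗ id
  fs≗id = proj₂ ∘ f-surj
  π = permutation f s fs≗id (rightInverse⇒leftInverse f s fs≗id)
  pointwise : ∀ u v → ⟦ adj? L u v ⟧ ≤ ⟦ adj? L′ (f u) (f v) ⟧
  pointwise u v = ⟦⟧-≤ (adj? L u v) (adj? L′ (f u) (f v)) (f-hom u v)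
  reindex : adjacentPairs L′ ≡ ∑[ u < n ] ∑[ v < n ] ⟦ adj? L′ (f u) (f v) ⟧
  reindex = trans (sum-permute (λ u → ∑[ v < n ] ⟦ adj? L′ u v ⟧) π)
                  (sum-cong-≗ λ u → sum-permute (λ v → ⟦ adj? L′ (f u) v ⟧) π)
... | no ∄ = inj₂ λ H → hom-iso L L′ H f s fs≗id (rightInverse⇒leftInverse f s fs≗id)
        λ u v → mk⇔ (f-hom u v) λ fufv →
          decidable-stable (adj? L u v) λ ¬uv → ∄ (u , v , ¬uv , fufv)
  where
  s = proj₁ ∘ f-surj
  fs≗id : f ∘ s ≗ id
  fs≗id = proj₂ ∘ f-surj

-- An index of nonzero weight has `a i ≡ b i` or repeats the values at `i₀`. Hence `a i₀ < b i₀`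
-- would make each left term at most its right partner, strictly so at `i₀`.
weighted-sum-≮ : (c a b : Fin n → ℕ) (i₀ : Fin n) → 0 < c i₀ →
  (∀ i → c i ≡ 0 ⊎ a i ≡ b i ⊎ (a i ≡ a i₀ × b i ≡ b i₀)) →
  ∑[ i < n ] (c i * a i) ≡ ∑[ i < n ] (c i * b i) → ¬ a i₀ < b i₀
weighted-sum-≮ c a b i₀ 0<c cases eq a<b = ℕ.<⇒≢
  (sum-mono-< (λ i → c i * a i) (λ i → c i * b i) pointwise i₀
    (ℕ.*-monoʳ-< (c i₀) {{>-nonZero 0<c}} a<b)) eq
  where
  pointwise : ∀ i → c i * a i ≤ c i * b i
  pointwise i with cases i
  ... | inj₁ ci≡0 rewrite ci≡0 = z≤n
  ... | inj₂ (inj₁ ai≡bi) = ℕ.≤-reflexive (cong (c i *_) ai≡bi)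
  ... | inj₂ (inj₂ (ai≡ , bi≡)) = ℕ.*-monoʳ-≤ (c i) (subst₂ _≤_ (sym ai≡) (sym bi≡) (ℕ.<⇒≤ a<b))

-- Isolating the terms of a sum over graphs of equal order.

module _ (L : Fin n → SimpleGraph) (orders : ∀ i j → order (L i) ≡ order (L j)) (H H′ : SimpleGraph)
  (sums-agree : ∀ T → ∑[ i < n ] (hom (L i) T * hom (L i) H) ≡ ∑[ i < n ] (hom (L i) T * hom (L i) H′))
  where

  -- Inclusion–exclusion over the vertices of T that are required to be hit.
  covering-sums-agree : ∀ T {P : Pred (V T) 0ℓ} (P? : Decidable P) vs →
    ∑[ i < n ] (coveringHoms (L i) T P? vs * hom (L i) H)
      ≡ ∑[ i < n ] (coveringHoms (L i) T P? vs * hom (L i) H′)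
  covering-sums-agree T P? [] = trans (base H) (trans (sums-agree (T ↾ elem (enumerate P?))) (sym (base H′)))
    where
    base : ∀ H → ∑[ i < n ] (coveringHoms (L i) T P? [] * hom (L i) H)
               ≡ ∑[ i < n ] (hom (L i) (T ↾ elem (enumerate P?)) * hom (L i) H)
    base H = sum-cong-≗ λ i → cong (_* hom (L i) H) (coveringHoms-[] (L i) T P?)
  covering-sums-agree T P? (v ∷ vs) = ℕ.+-cancelʳ-≡ _ _ _ (trans (step H)
    (trans (covering-sums-agree T P? vs)
    (sym (trans (cong (_ +_) (covering-sums-agree T P′? vs)) (step H′)))))
    where
    P′? = λ x → P? x ×-dec ¬? (x ≟ v)
    step : ∀ H → ∑[ i < n ] (coveringHoms (L i) T P? (v ∷ vs) * hom (L i) H)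
               + ∑[ i < n ] (coveringHoms (L i) T P′? vs * hom (L i) H)
               ≡ ∑[ i < n ] (coveringHoms (L i) T P? vs * hom (L i) H)
    step H = trans
      (sym (∑-distrib-+ (λ i → coveringHoms (L i) T P? (v ∷ vs) * hom (L i) H)
                        (λ i → coveringHoms (L i) T P′? vs * hom (L i) H)))
      (sum-cong-≗ λ i → trans
        (sym (ℕ.*-distribʳ-+ (hom (L i) H) (coveringHoms (L i) T P? (v ∷ vs)) _))
        (cong (_* hom (L i) H) (coveringHoms-∷ (L i) T P? v vs)))

  surjective-sums-agree : ∀ T → ∑[ i < n ] (surjectiveHoms (L i) T * hom (L i) H)
                              ≡ ∑[ i < n ] (surjectiveHoms (L i) T * hom (L i) H′)
  surjective-sums-agree T = covering-sums-agree T U? (allFin (order T))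

  -- By induction on the number of edges of L i₀: an L i with a surjective homomorphism to
  -- L i₀ either has fewer edges or is isomorphic to L i₀.
  isolate : ∀ i → hom (L i) H ≡ hom (L i) H′
  isolate i = below (suc (adjacentPairs (L i))) i ℕ.≤-refl
    where
    below : ∀ b i → adjacentPairs (L i) < b → hom (L i) H ≡ hom (L i) H′
    cases : ∀ b i₀ → adjacentPairs (L i₀) ≤ b → ∀ i → surjectiveHoms (L i) (L i₀) ≡ 0
            ⊎ hom (L i) H ≡ hom (L i) H′
            ⊎ (hom (L i) H ≡ hom (L i₀) H × hom (L i) H′ ≡ hom (L i₀) H′)
    below (suc b) i₀ (s≤s size≤b) with ℕ.<-cmp (hom (L i₀) H) (hom (L i₀) H′)
    ... | tri≈ _ eq _ = eq
    ... | tri< lt _ _ = contradiction lt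
      (weighted-sum-≮ (λ i → surjectiveHoms (L i) (L i₀)) (λ i → hom (L i) H) (λ i → hom (L i) H′) i₀
        (surjectiveHoms-positive (L i₀)) (cases b i₀ size≤b) (surjective-sums-agree (L i₀)))
    ... | tri> _ _ gt = contradiction gt
      (weighted-sum-≮ (λ i → surjectiveHoms (L i) (L i₀)) (λ i → hom (L i) H′) (λ i → hom (L i) H) i₀
        (surjectiveHoms-positive (L i₀)) (Sum.map₂ (Sum.map sym swap) ∘ cases b i₀ size≤b)
        (sym (surjective-sums-agree (L i₀))))
    cases b i₀ size≤b i with surjectiveHoms (L i) (L i₀) ℕ.≟ 0
    ... | yes none = inj₁ none
    ... | no  some with surjectiveHoms≢0⇒∃ (L i) (L i₀) some
    ...   | f , f-hom , f-surj
            with surjective-hom⇒smaller-or-iso (L i) (L i₀) (orders i i₀) f f-hom f-surj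
    ...     | inj₁ smaller = inj₂ (inj₁ (below b i (ℕ.<-≤-trans smaller size≤b)))
    ...     | inj₂ iso     = inj₂ (inj₂ (iso H , iso H′))

-- Recovering the count of an induced subgraph from colourings.

^-injectiveˡ : ∀ n .{{_ : NonZero n}} → m ^ n ≡ k ^ n → m ≡ k
^-injectiveˡ {m} {k} n eq with ℕ.<-cmp m k
... | tri≈ _ m≡k _ = m≡k
... | tri< m<k _ _ = contradiction eq (ℕ.<⇒≢ (ℕ.^-monoˡ-< n m<k))
... | tri> _ _ k<m = contradiction (sym eq) (ℕ.<⇒≢ (ℕ.^-monoˡ-< n k<m))

hom-all : ∀ F G → (∀ f → IsHom F G f) → hom F G ≡ order G ^ order F
hom-all F G all-hom = begin
  hom F G
    ≡⟨ hom-∑ F G ⟩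
  (∑maps (order F) (order G) λ f → ⟦ isHom? F G f ⟧)
    ≡⟨ ∑maps-cong (λ f → ⟦⟧-yes (isHom? F G f) (all-hom f)) ⟩
  (∑maps (order F) (order G) λ _ → 1)
    ≡⟨ sum-const (order G ^ order F) 1 ⟩
  order G ^ order F * 1
    ≡⟨ ℕ.*-identityʳ _ ⟩
  order G ^ order F ∎
  where open ≡-Reasoning

hom-∣-ext : ∀ F {g g′ : V F → Fin k} H → g ≗ g′ → hom (F ∣ g) H ≡ hom (F ∣ g′) H
hom-∣-ext F {g} {g′} H g≗g′ = hom-iso (F ∣ g) (F ∣ g′) H id id (λ _ → refl) (λ _ → refl)
  λ u v → mk⇔ (λ (uv , eq) → uv , trans (sym (g≗g′ u)) (trans eq (g≗g′ v)))
              (λ (uv , eq) → uv , trans (g≗g′ u) (trans eq (sym (g≗g′ v))))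

-- Any two vertices of `complete N` are equal or adjacent, so every `g` has weight one. The result
-- has the form of the sums in `sums-agree`.
hom-complete-lex : ∀ F N T H → hom F (complete N · (T ⊗ H)) ≡
  ∑maps (order F) N λ g → hom (F ∣ g) T * hom (F ∣ g) H
hom-complete-lex F N T H = trans (hom-lex F (complete N) (T ⊗ H)) (∑maps-cong {order F} {N} λ g →
  trans (cong₂ _*_ (⟦⟧-yes (edgesToEdgesOrPoints? F (complete N) g) λ u v _ → equal-or-adjacent (g u) (g v))
                   (hom-⊗ (F ∣ g) T H))
        (ℕ.*-identityˡ _))
  where
  equal-or-adjacent : ∀ i j → i ≡ j ⊎ i ≢ j
  equal-or-adjacent i j with i ≟ j
  ... | yes i≡j = inj₁ i≡j
  ... | no  i≢j = inj₂ i≢j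

module _ (K : SimpleGraph) (e : Fin k → V K) (e-injective : Injective _≡_ _≡_ e) where

  private
    outside : Enumeration (λ u → ¬ Hits e u)
    outside = enumerate (λ u → ¬? (hits? e u))

  -- The shift by `suc` frees `zero` as the common colour for the range of `e`; all other vertices
  -- keep private colours, so only the edges of `K ↾ e` survive in `K ∣ collapse`.
  collapse : V K → Fin (suc (order K))
  collapse u with hits? e u
  ... | yes _ = zero
  ... | no  _ = suc u

  collapse-hit : ∀ {u} → Hits e u → collapse u ≡ zero
  collapse-hit {u} hit with hits? e u
  ... | yes _    = refl
  ... | no  miss = contradiction hit miss

  collapse-miss : ∀ {u} → ¬ Hits e u → collapse u ≡ suc u
  collapse-miss {u} miss with hits? e u
  ... | yes hit = contradiction hit miss
  ... | no  _   = refl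

  hom-collapse : ∀ H → hom (K ∣ collapse) H ≡ hom (K ↾ e) H * order H ^ size outside
  hom-collapse H = begin
    hom (K ∣ collapse) H
      ≡⟨ hom-disjoint (K ∣ collapse) H e e₂ e-injective (elem-injective outside)
           (λ i j eq → elem-∈ outside j (i , eq))
           cover
           (λ i j (_ , eq) → 0≢1+n (trans (sym (collapse-hit (i , refl)))
              (trans eq (collapse-miss (elem-∈ outside j))))) ⟩
    hom (K ∣ collapse ↾ e) H * hom (K ∣ collapse ↾ e₂) H
      ≡⟨ cong₂ _*_
           (hom-iso (K ∣ collapse ↾ e) (K ↾ e) H id id (λ _ → refl) (λ _ → refl)
             λ i j → mk⇔ proj₁ (λ ij → ij , trans (collapse-hit (i , refl)) (sym (collapse-hit (j , refl)))))
           (hom-all (K ∣ collapse ↾ e₂) H λ _ i j (ij , eq) → ⊥-elim (loopless K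
             (suc-injective (trans (sym (collapse-miss (elem-∈ outside i)))
               (trans eq (collapse-miss (elem-∈ outside j))))) ij)) ⟩
    hom (K ↾ e) H * order H ^ size outside ∎
    where
    open ≡-Reasoning
    e₂ = elem outside
    cover : ∀ u → Hits e u ⊎ Hits e₂ u
    cover u with hits? e u
    ... | yes hit  = inj₁ hit
    ... | no  miss = inj₂ (index outside u miss)

  -- The colouring `collapse` gives the equality up to powers of the orders, and the colouring `id`
  -- gives the equality of orders needed to cancel them.
  hom-↾-cong : ∀ H H′ → (∀ {N} (g : V K → Fin N) → hom (K ∣ g) H ≡ hom (K ∣ g) H′) →
               hom (K ↾ e) H ≡ hom (K ↾ e) H′
  hom-↾-cong H H′ colourings = cancel (size outside) (elem outside)
    (trans (sym (hom-collapse H)) (trans (colourings collapse) (hom-collapse H′)))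
    where
    discrete : ∀ H → hom (K ∣ id) H ≡ order H ^ order K
    discrete H = hom-all (K ∣ id) H λ _ _ _ (uv , u≡v) → ⊥-elim (loopless K u≡v uv)
    -- A vertex of `K` makes the exponent positive; for empty `K` the powers are both `1` and say
    -- nothing about the orders.
    same-order : V K → order H ≡ order H′
    same-order u = ^-injectiveˡ (order K) {{nonZero u}}
      (trans (sym (discrete H)) (trans (colourings id) (discrete H′)))
      where
      nonZero : Fin m → NonZero m
      nonZero zero    = _
      nonZero (suc _) = _
    empty-target : ∀ H → order H ≡ 0 → hom (K ↾ e) H ≡ 0 ^ k
    empty-target H@record{ order = zero } refl = hom-all (K ↾ e) H λ f i → contradiction (f i) λ ()
    -- For positive `l`, `e₂` supplies the vertex of `K` that `same-order` asks for.
    cancel : ∀ l (e₂ : Fin l → V K) → hom (K ↾ e) H * order H ^ l ≡ hom (K ↾ e) H′ * order H′ ^ l →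
             hom (K ↾ e) H ≡ hom (K ↾ e) H′
    cancel zero    _  eq = ℕ.*-cancelʳ-≡ _ _ 1 eq
    cancel (suc l) e₂ eq with order H ℕ.≟ 0
    ... | yes |H|≡0 = trans (empty-target H |H|≡0)
      (sym (empty-target H′ (trans (sym (same-order (e₂ zero))) |H|≡0)))
    ... | no  |H|≢0 = ℕ.*-cancelʳ-≡ _ _ (order H ^ suc l) {{ℕ.m^n≢0 (order H) (suc l) {{≢-nonZero |H|≢0}}}}
      (trans eq (cong (λ m → hom (K ↾ e) H′ * m ^ suc l) (sym (same-order (e₂ zero)))))

-- Left lexicographic products and the closure of `cl 𝓕`.

preserved⇒cl-closed : ∀ {ℓ} (𝓕 : Pred SimpleGraph ℓ) →
                      PreservedUnderLeftLex 𝓕 → ClosedUnderInducedSubgraphs (cl 𝓕)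
preserved⇒cl-closed 𝓕 preserved K K′ K∈cl (e , e-injective , e-adj) H H′ H≡H′ = begin
  hom K′ H           ≡⟨ same H ⟩
  hom (K ↾ e) H      ≡⟨ hom-↾-cong K e e-injective H H′ colourings ⟩
  hom (K ↾ e) H′     ≡⟨ same H′ ⟨
  hom K′ H′          ∎
  where
  open ≡-Reasoning
  same : ∀ H → hom K′ H ≡ hom (K ↾ e) H
  same H = hom-iso K′ (K ↾ e) H id id (λ _ → refl) (λ _ → refl) e-adj
  ⊗-equivalent : ∀ T → (T ⊗ H) ≡[ 𝓕 ] (T ⊗ H′)
  ⊗-equivalent T F F∈𝓕 = trans (hom-⊗ F T H)
    (trans (cong (hom F T *_) (H≡H′ F F∈𝓕)) (sym (hom-⊗ F T H′)))
  colourings : ∀ {N} (g : V K → Fin N) → hom (K ∣ g) H ≡ hom (K ∣ g) H′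
  colourings {N} g = begin
    hom (K ∣ g) H
      ≡⟨ hom-∣-ext K H (finToFun-funToFin g) ⟨
    hom (K ∣ finToFun (funToFin g)) H
      -- The family consists of all colourings with `N` colours, each graph on the vertices of `K`,
      -- so equality of orders is `refl`. As `T` is arbitrary, `K∈cl` applied to the preserved
      -- products yields `sums-agree`.
      ≡⟨ isolate (λ i → K ∣ finToFun {N} i) (λ _ _ → refl) H H′
           (λ T → trans (sym (hom-complete-lex K N T H))
             (trans (K∈cl (complete N · (T ⊗ H)) (complete N · (T ⊗ H′))
               (preserved (complete N) (T ⊗ H) (T ⊗ H′) (⊗-equivalent T)))
               (hom-complete-lex K N T H′)))
           (funToFin g) ⟩
    hom (K ∣ finToFun (funToFin g)) H′
      ≡⟨ hom-∣-ext K H′ (finToFun-funToFin g) ⟩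
    hom (K ∣ g) H′ ∎

-- Equivalence over `𝓕` implies equivalence over `cl 𝓕` by the definition of `cl`, and `𝓕` is
-- contained in `cl 𝓕`; so the first implication for `cl 𝓕` suffices.
cl-closed⇒preserved : ∀ {ℓ} (𝓕 : Pred SimpleGraph ℓ) →
                      ClosedUnderInducedSubgraphs (cl 𝓕) → PreservedUnderLeftLex 𝓕
cl-closed⇒preserved 𝓕 closed G H H′ H≡H′ F F∈𝓕 =
  closed⇒preserved (cl 𝓕) closed G H H′ (λ K K∈cl → K∈cl H H′ H≡H′) F (λ _ _ h → h F F∈𝓕)

theorem14 : ∀ {ℓ : Level} (𝓕 : Pred SimpleGraph ℓ) →
  (ClosedUnderInducedSubgraphs 𝓕 → PreservedUnderLeftLex 𝓕)
  × (PreservedUnderLeftLex 𝓕 ⇔ ClosedUnderInducedSubgraphs (cl 𝓕))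
theorem14 𝓕 = closed⇒preserved 𝓕 , mk⇔ (preserved⇒cl-closed 𝓕) (cl-closed⇒preserved 𝓕)
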